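{- Let $(\mathcal{N},\mathcal{I})$ be a matroid with $|\mathcal{N}|=n$ and rank $r$, and let $f:2^{\mathcal{N}}\to\mathbb{R}$ be a non-monotone, non-negative submodular function. Then the algorithm TwinGreedy (described in the context), run on $(\mathcal{N},\mathcal{I},f)$, returns a solution $S^*$ with $\frac14$ approximation ratio for the problem $\max\{f(S):S\in\mathcal{I}\}$, i.e. $S^*\in\mathcal{I}$ and $f(S^*)\ge \frac14\max\{f(S):S\in\mathcal{I}\}$, under time complexity of $\mathcal{O}(nr)$.
   Context: Submodular: $f(X)+f(Y)\ge f(X\cup Y)+f(X\cap Y)$ for all $X,Y\subseteq\mathcal{N}$. Non-negative: $f(X)\ge 0$ for all $X\subseteq\mathcal{N}$. Non-monotone: there exist $X\subset Y\subseteq\mathcal{N}$ with $f(X)>f(Y)$. Marginal gain: $f(X\mid Y)=f(X\cup Y)-f(Y)$, and $f(x\mid Y)=f(\{x\}\mid Y)$ for $x\in\mathcal{N}$. A matroid $(\mathcal{N},\mathcal{I})$ consists of a finite ground set $\mathcal{N}$ and a family $\mathcal{I}\subseteq 2^{\mathcal{N}}$ of independent sets such that: $\emptyset\in\mathcal{I}$; if $A\subseteq B\in\mathcal{I}$ then $A\in\mathcal{I}$; and if $A,B\in\mathcal{I}$ with $|A|<|B|$, then there exists $x\in B\setminus A$ with $A\cup\{x\}\in\mathcal{I}$. Its rank is $r=\max\{|S|:S\in\mathcal{I}\}$. Algorithm TwinGreedy: start with $S_1=S_2=\emptyset$. Repeat the following. For $j\in\{1,2\}$ let $\mathcal{M}_j=\{e\in\mathcal{N}\setminus(S_1\cup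 S_2): S_j\cup\{e\}\in\mathcal{I}\}$. If $\mathcal{M}_1\cup\mathcal{M}_2=\emptyset$, stop the loop. Otherwise choose a pair $(i,e)$ maximizing $f(u\mid S_j)$ over all pairs $(j,u)$ with $j\in\{1,2\}$, $u\in\mathcal{M}_j$ (ties broken arbitrarily); if $f(e\mid S_i)\le 0$, stop the loop; otherwise replace $S_i$ by $S_i\cup\{e\}$ and continue. When the loop has stopped, return $S^*\in\arg\max_{X\in\{S_1,S_2\}}f(X)$. -}

module Defs where

open import Data.Bool.Base using (Bool; true; false; if_then_else_; _∨_)
open import Data.Fin.Base using (Fin; zero; suc)
open import Data.Fin.Subset using (Subset; ⊥; ⁅_⁆; _∈_; _∉_; _⊆_; _⊂_; _∪_; _∩_; ∣_∣)
open import Data.List.Base using (List; []; _∷_; allFin; cartesianProduct)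
open import Data.Maybe.Base using (Maybe; just; nothing)
open import Data.Nat.Base as ℕ using (ℕ; zero; suc)
import Data.Nat.Properties as ℕ
open import Data.Product.Base using (∃; ∃₂; _×_; _,_)
open import Data.Rational.Base as ℚ using (ℚ; 0ℚ; 1ℚ; ½)
import Data.Rational.Properties as ℚ
open import Data.Rational.Solver using (module +-*-Solver)
open import Data.Sum.Base using (_⊎_; inj₁; inj₂; [_,_]′)
open import Data.Vec.Base using (Vec; []; _∷_; lookup; _[_]≔_)
open import Induction.WellFounded using (Acc)
open import Relation.Binary.PropositionalEquality
open import Relation.Nullary.Negation.Core using (¬_)
open import Relation.Nullary.Reflects using (Reflects)

------------------------------------------------------------------------
-- Real numbers, as Cauchy sequences of rationals

infix  4 _≤_ _<_
infixl 6 _+_ _-_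
infix  8 -_
infixr 7 _·_

record ℝ : Set where
  field
    seq    : ℕ → ℚ
    cauchy : ∀ ε → 0ℚ ℚ.< ε → ∃ λ N → ∀ m n → N ℕ.≤ m → N ℕ.≤ n →
             ℚ.∣ seq m ℚ.- seq n ∣ ℚ.< ε

open ℝ public

-- Two sequences have the same limit when each is _≤_ the other.

_≤_ : ℝ → ℝ → Set
x ≤ y = ∀ ε → 0ℚ ℚ.< ε → ∃ λ N → ∀ n → N ℕ.≤ n → seq x n ℚ.≤ seq y n ℚ.+ ε

_<_ : ℝ → ℝ → Set
x < y = ∃ λ ε → 0ℚ ℚ.< ε × ∃ λ N → ∀ n → N ℕ.≤ n → seq x n ℚ.+ ε ℚ.≤ seq y n

fromℚ : ℚ → ℝ
fromℚ q .seq _ = q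
fromℚ q .cauchy ε 0<ε = 0 , λ _ _ _ _ →
  subst (λ p → ℚ.∣ p ∣ ℚ.< ε) (sym (ℚ.+-inverseʳ q)) 0<ε

0ℝ : ℝ
0ℝ = fromℚ 0ℚ

private
  half-pos : ∀ ε → 0ℚ ℚ.< ε → 0ℚ ℚ.< ½ ℚ.* ε
  half-pos ε 0<ε = ℚ.*-monoʳ-<-pos ½ 0<ε

  half+half : ∀ ε → ½ ℚ.* ε ℚ.+ ½ ℚ.* ε ≡ ε
  half+half ε = trans (sym (ℚ.*-distribʳ-+ ε ½ ½)) (ℚ.*-identityˡ ε)

  +-interchange : ∀ a b c d →
    (a ℚ.+ b) ℚ.- (c ℚ.+ d) ≡ (a ℚ.- c) ℚ.+ (b ℚ.- d)
  +-interchange = solve 4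
    (λ a b c d → (a :+ b) :- (c :+ d) := (a :- c) :+ (b :- d)) refl
    where open +-*-Solver

  neg-sub : ∀ a b → ℚ.- a ℚ.- ℚ.- b ≡ ℚ.- (a ℚ.- b)
  neg-sub = solve 2 (λ a b → (:- a) :- (:- b) := :- (a :- b)) refl
    where open +-*-Solver

  *-sub : ∀ q a b → q ℚ.* a ℚ.- q ℚ.* b ≡ q ℚ.* (a ℚ.- b)
  *-sub = solve 3 (λ q a b → q :* a :- q :* b := q :* (a :- b)) refl
    where open +-*-Solver

  *-continuous : ∀ q ε → 0ℚ ℚ.< ε →
    ∃ λ δ → 0ℚ ℚ.< δ × (∀ p → ℚ.∣ p ∣ ℚ.< δ → ℚ.∣ q ℚ.* p ∣ ℚ.< ε)
  *-continuous q ε 0<ε = δ , 0<δ , λ p ∣p∣<δ → begin-strict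
    ℚ.∣ q ℚ.* p ∣         ≡⟨ ℚ.∣p*q∣≡∣p∣*∣q∣ q p ⟩
    ℚ.∣ q ∣ ℚ.* ℚ.∣ p ∣   ≤⟨ ℚ.*-monoʳ-≤-nonNeg ℚ.∣ p ∣ {{ℚ.∣-∣-nonNeg p}} ∣q∣≤K ⟩
    K ℚ.* ℚ.∣ p ∣         <⟨ ℚ.*-monoʳ-<-pos K ∣p∣<δ ⟩
    K ℚ.* (ℚ.1/ K ℚ.* ε)  ≡⟨ ℚ.*-assoc K (ℚ.1/ K) ε ⟨
    K ℚ.* ℚ.1/ K ℚ.* ε    ≡⟨ cong (ℚ._* ε) (ℚ.*-inverseʳ K) ⟩
    1ℚ ℚ.* ε              ≡⟨ ℚ.*-identityˡ ε ⟩
    ε                     ∎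
    where
    open ℚ.≤-Reasoning
    K : ℚ
    K = 1ℚ ℚ.+ ℚ.∣ q ∣
    instance
      K-pos : ℚ.Positive K
      K-pos = ℚ.pos+nonNeg⇒pos 1ℚ ℚ.∣ q ∣ {{ℚ.∣-∣-nonNeg q}}
      K-nonZero : ℚ.NonZero K
      K-nonZero = ℚ.pos⇒nonZero K
    ∣q∣≤K : ℚ.∣ q ∣ ℚ.≤ K
    ∣q∣≤K = subst (ℚ._≤ K) (ℚ.+-identityˡ ℚ.∣ q ∣)
      (ℚ.+-monoˡ-≤ ℚ.∣ q ∣ (ℚ.nonNegative⁻¹ 1ℚ))
    δ : ℚ
    δ = ℚ.1/ K ℚ.* ε
    0<δ : 0ℚ ℚ.< δ
    0<δ = subst (ℚ._< δ) (ℚ.*-zeroʳ (ℚ.1/ K))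
      (ℚ.*-monoʳ-<-pos (ℚ.1/ K) {{ℚ.1/pos⇒pos K}} 0<ε)

_+_ : ℝ → ℝ → ℝ
(x + y) .seq n = seq x n ℚ.+ seq y n
(x + y) .cauchy ε 0<ε
  with M , close-x ← cauchy x (½ ℚ.* ε) (half-pos ε 0<ε)
     | N , close-y ← cauchy y (½ ℚ.* ε) (half-pos ε 0<ε)
  = M ℕ.⊔ N , λ m n ≤m ≤n → begin-strict
    ℚ.∣ (seq x m ℚ.+ seq y m) ℚ.- (seq x n ℚ.+ seq y n) ∣
      ≡⟨ cong ℚ.∣_∣ (+-interchange (seq x m) (seq y m) (seq x n) (seq y n)) ⟩
    ℚ.∣ (seq x m ℚ.- seq x n) ℚ.+ (seq y m ℚ.- seq y n) ∣
      ≤⟨ ℚ.∣p+q∣≤∣p∣+∣q∣ (seq x m ℚ.- seq x n) (seq y m ℚ.- seq y n) ⟩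
    ℚ.∣ seq x m ℚ.- seq x n ∣ ℚ.+ ℚ.∣ seq y m ℚ.- seq y n ∣
      <⟨ ℚ.+-mono-<
           (close-x m n (ℕ.m⊔n≤o⇒m≤o M N ≤m) (ℕ.m⊔n≤o⇒m≤o M N ≤n))
           (close-y m n (ℕ.m⊔n≤o⇒n≤o M N ≤m) (ℕ.m⊔n≤o⇒n≤o M N ≤n)) ⟩
    ½ ℚ.* ε ℚ.+ ½ ℚ.* ε
      ≡⟨ half+half ε ⟩
    ε ∎
  where open ℚ.≤-Reasoning

-_ : ℝ → ℝ
(- x) .seq n = ℚ.- seq x n
(- x) .cauchy ε 0<ε with N , close ← cauchy x ε 0<ε
  = N , λ m n ≤m ≤n → subst (ℚ._< ε)
    (sym (trans (cong ℚ.∣_∣ (neg-sub (seq x m) (seq x n)))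
                (ℚ.∣-p∣≡∣p∣ (seq x m ℚ.- seq x n))))
    (close m n ≤m ≤n)

_-_ : ℝ → ℝ → ℝ
x - y = x + (- y)

_·_ : ℚ → ℝ → ℝ
(q · x) .seq n = q ℚ.* seq x n
(q · x) .cauchy ε 0<ε
  with δ , 0<δ , small ← *-continuous q ε 0<ε
  with N , close ← cauchy x δ 0<δ
  = N , λ m n ≤m ≤n → subst (λ p → ℚ.∣ p ∣ ℚ.< ε)
    (sym (*-sub q (seq x m) (seq x n)))
    (small (seq x m ℚ.- seq x n) (close m n ≤m ≤n))

------------------------------------------------------------------------
-- Set functions and matroids on the ground set Fin n

module _ {n : ℕ} (f : Subset n → ℝ) where

  Submodular : Set
  Submodular = ∀ X Y → f (X ∪ Y) + f (X ∩ Y) ≤ f X + f Y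

  NonNegative : Set
  NonNegative = ∀ X → 0ℝ ≤ f X

  NonMonotone : Set
  NonMonotone = ∃₂ λ X Y → X ⊂ Y × f Y < f X

record Matroid (n : ℕ) : Set₁ where
  field
    Independent   : Subset n → Set
    ⊥-independent : Independent ⊥
    hereditary    : ∀ {A B} → A ⊆ B → Independent B → Independent A
    exchange      : ∀ {A B} → Independent A → Independent B → ∣ A ∣ ℕ.< ∣ B ∣ →
                    ∃ λ x → x ∈ B × x ∉ A × Independent (A ∪ ⁅ x ⁆)

open Matroid public

HasRank : ∀ {n} → Matroid n → ℕ → Set
HasRank M r = (∃ λ S → Independent M S × ∣ S ∣ ≡ r)
            × (∀ S → Independent M S → ∣ S ∣ ℕ.≤ r)

-- α · max { f O ∣ O independent } ≤ f S, the maximum being over a finite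
-- nonempty family.

Approximates : ∀ {n} → Matroid n → (Subset n → ℝ) → ℚ → Subset n → Set
Approximates M f α S =
  Independent M S × (∀ O → Independent M O → α · f O ≤ f S)

------------------------------------------------------------------------
-- Oracle programs

-- Programs can learn about the matroid and the function only through the
-- queries `independent?` and `value`.  Every `Op` takes unit time, including
-- set membership and insertion (sets as bit arrays).

data Op (n : ℕ) : Set → Set where
  independent? : Subset n → Op n Bool
  value        : Subset n → Op n ℝ
  member?      : Fin n → Subset n → Op n Bool
  insert       : Fin n → Subset n → Op n (Subset n)
  subtract     : ℝ → ℝ → Op n ℝ
  nonpositive? : ℝ → Op n Bool
  compare      : ℝ → ℝ → Op n Bool

data Comp (n : ℕ) (A : Set) : Set₁ where
  return : A → Comp n A
  call   : ∀ {B} → Op n B → (B → Comp n A) → Comp n A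
  loop   : ∀ {X Y} → (X → Comp n (X ⊎ Y)) → X → (Y → Comp n A) → Comp n A

infixl 1 _>>=_

_>>=_ : ∀ {n A B} → Comp n A → (A → Comp n B) → Comp n B
return x        >>= h = h x
call o k        >>= h = call o (λ x → k x >>= h)
loop body x₀ k  >>= h = loop body x₀ (λ y → k y >>= h)

perform : ∀ {n A} → Op n A → Comp n A
perform o = call o return

-- `loop body x` runs `body x` and either repeats with a new state (inj₁)
-- or stops with a result (inj₂).

while : ∀ {n X Y} → (X → Comp n (X ⊎ Y)) → X → Comp n Y
while body x = loop body x return

module Execution {n : ℕ} (M : Matroid n) (f : Subset n → ℝ) where

  -- If x and y are equal then `compare x y` may give either answer: this
  -- is what makes tie-breaking arbitrary.

  Answers : ∀ {B} → Op n B → B → Set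
  Answers (independent? S) b = Reflects (Independent M S) b
  Answers (value S)        x = x ≡ f S
  Answers (member? e S)    b = Reflects (e ∈ S) b
  Answers (insert e S)     T = T ≡ S ∪ ⁅ e ⁆
  Answers (subtract x y)   z = z ≡ x - y
  Answers (nonpositive? x) b = Reflects (x ≤ 0ℝ) b
  Answers (compare x y)    b = if b then x ≤ y else y ≤ x

  infix 3 _⟶_ _⟶[_]_

  data _⟶_ {A : Set} : Comp n A → Comp n A → Set₁ where
    answer : ∀ {B} {o : Op n B} {k x} → Answers o x → call o k ⟶ k x
    unroll : ∀ {X Y} {body : X → Comp n (X ⊎ Y)} {x k} →
             loop body x k ⟶ (body x >>= [ (λ x′ → loop body x′ k) , k ]′)

  -- p ⟶[ t ] q: some execution leads from p to q in t units of time.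

  data _⟶[_]_ {A : Set} : Comp n A → ℕ → Comp n A → Set₁ where
    done : ∀ {p} → p ⟶[ 0 ] p
    step : ∀ {p q s t} → p ⟶ q → q ⟶[ t ] s → p ⟶[ suc t ] s

  Halted : ∀ {A} → Comp n A → Set₁
  Halted p = ∀ q → ¬ (p ⟶ q)

  -- p has no infinite execution.

  Terminates : ∀ {A} → Comp n A → Set₁
  Terminates = Acc (λ q p → p ⟶ q)

------------------------------------------------------------------------
-- TwinGreedy

module _ {n : ℕ} where

  -- The pair (S₁ , S₂), with j ∈ {1,2} represented by Fin 2.

  Twins : Set
  Twins = Vec (Subset n) 2

  -- A pair (j , u) with its gain f(u ∣ S_j) = f(S_j ∪ {u}) - f(S_j).

  Candidate : Set
  Candidate = Fin 2 × Fin n × ℝ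

  better : Maybe Candidate → Candidate → Comp n Candidate
  better nothing              c           = return c
  better (just (i , e , g)) (j , u , h) =
    perform (compare h g) >>= λ keep →
    return (if keep then (i , e , g) else (j , u , h))

  -- Updates the best candidate so far with (j , u), provided u ∈ 𝓜_j.

  consider : Twins → Fin 2 → Fin n → Maybe Candidate → Comp n (Maybe Candidate)
  consider S j u best =
    perform (member? u (lookup S zero))       >>= λ in₁ →
    perform (member? u (lookup S (suc zero))) >>= λ in₂ →
    if in₁ ∨ in₂ then return best else (
    perform (insert u (lookup S j))           >>= λ T →
    perform (independent? T)                  >>= λ ind →
    if ind then (
      perform (value T)                       >>= λ a →
      perform (value (lookup S j))            >>= λ b →
      perform (subtract a b)                  >>= λ gain →
      better best (j , u , gain)              >>= λ c →
      return (just c))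
    else return best)

  scan : Twins → List (Fin 2 × Fin n) → Maybe Candidate → Comp n (Maybe Candidate)
  scan S []             best = return best
  scan S ((j , u) ∷ us) best = consider S j u best >>= scan S us

  iteration : Twins → Comp n (Twins ⊎ Twins)
  iteration S =
    scan S (cartesianProduct (allFin 2) (allFin n)) nothing >>= λ where
      nothing             → return (inj₂ S)
      (just (i , e , gain)) →
        perform (nonpositive? gain) >>= λ stop →
        if stop then return (inj₂ S) else (
        perform (insert e (lookup S i)) >>= λ T →
        return (inj₁ (S [ i ]≔ T)))

  twinGreedy : Comp n (Subset n)
  twinGreedy =
    while iteration (⊥ ∷ ⊥ ∷ [])              >>= λ S →
    perform (value (lookup S zero))           >>= λ a →
    perform (value (lookup S (suc zero)))     >>= λ b →
    perform (compare a b)                     >>= λ second →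
    return (lookup S (if second then suc zero else zero))

module Submission where

-- Let S₁, S₂ be the final pair, S* the better of the two, and O independent.
-- Since S₁ and S₂ are disjoint, (S₁ ∪ O) ∩ (S₂ ∪ O) = O, so submodularity and
-- non-negativity give f (S₁ ∪ O) + f (S₂ ∪ O) ≥ f O.  It is therefore enough
-- to bound the left-hand side by 2 (f S₁ + f S₂), which is at most 4 f S*.
--
-- The bound is proved by amortization.  Along the run, sets Tⱼ with
-- Sⱼ ⊆ Tⱼ ⊆ Sⱼ ∪ O record which elements of O have been charged on side j
-- (`Cover`): the uncharged elements O ∖ Tⱼ lie in neither S₁ nor S₂, and
-- together with Sⱼ they form an independent set, so each of them is a
-- candidate for Sⱼ, and its gain is at most that of the next greedy addition.
-- The invariant (`Charged`) is
--
--   f T₁ + f T₂ ≤ 2 (f S₁ + f S₂).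
--
-- Adding e to S₁ with gain δ x≤x+δs the right-hand side by 2 δ.  On the left,
-- e may enter T₁ and T₂, and by the exchange property (`exchange-one`) at most
-- one further element enters T₁ to keep the uncharged elements compatible with
-- S₁ ∪ {e}.  By diminishing returns (`diminishing`) each of the three costs at
-- most δ, and in every case one of them costs nothing (`charged-grow`).
-- Additions to S₂ are symmetric.  When the run stops, no candidate has positive
-- gain, so the uncharged elements are worthless and f (Sⱼ ∪ O) ≤ f Tⱼ
-- (`cover-bound`).
--
-- The program is treated by a Hoare logic with a step counter (`Ensures`)
-- whose loop rule composes a specification of the body with one of what
-- follows.  It yields termination, correctness of the result and the time
-- bound at once.  At most 2 r elements are added, as both sets stay
-- independent, so the loop body runs at most 2 r + 1 times; each run makes 2 n
-- calls of `consider`, of at most 8 steps each.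
--
-- The order on the reals is not decidable.  The proof only needs that x ≰ y
-- implies y ≤ x (`≰⇒≥`), for the sign of the gain of an added pair, and the
-- double negation of totality, to see that no comparison blocks.

open import Defs
open import Data.Bool.Base using (true; false; if_then_else_)
open import Data.Fin.Base using (Fin; zero; suc)
open import Data.Fin.Subset
  using (Subset; ⊥; ⁅_⁆; _∈_; _∉_; _⊆_; _∪_; _∩_; ∁; ∣_∣; inside; outside)
  renaming (_-_ to _without_)
open import Data.Fin.Subset.Induction using (⊂-wellFounded; Acc; acc)
open import Data.Fin.Subset.Properties
open import Data.Integer.Base using (+_)
open import Data.List.Base using (List; []; _∷_; length; map; allFin; cartesianProduct)
open import Data.List.Membership.Propositional.Properties using (∈-cartesianProduct⁺; ∈-allFin)
open import Data.List.Properties using (length-++; length-map; length-tabulate)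
open import Data.List.Relation.Unary.All as All using (All; []; _∷_)
open import Data.Maybe.Base using (Maybe; just; nothing)
open import Data.Nat.Base as ℕ using (ℕ; zero; suc)
import Data.Nat.Properties as ℕ
import Data.Nat.Solver as ℕSolver
open import Data.Product.Base using (∃; _×_; _,_; proj₁; proj₂)
open import Data.Rational.Base as ℚ using (ℚ; 0ℚ; ½; _/_)
import Data.Rational.Properties as ℚ
open import Data.Rational.Solver using (module +-*-Solver)
open import Data.Sum.Base using (_⊎_; inj₁; inj₂; [_,_]′)
open import Data.Unit.Base using (⊤; tt)
open import Data.Vec.Base using ([]; _∷_; here; there; lookup; _[_]≔_)
open import Function.Base using (_∘_; id)
open import Relation.Binary.PropositionalEquality
  using (_≡_; refl; sym; trans; cong; cong₂; subst; subst₂)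
open import Relation.Nullary using (¬_; Dec; yes; no; contradiction)
open import Relation.Nullary.Reflects using (ofʸ; ofⁿ)

-- The order on the reals

private
  half-pos : ∀ {ε} → 0ℚ ℚ.< ε → 0ℚ ℚ.< ½ ℚ.* ε
  half-pos 0<ε = ℚ.*-monoʳ-<-pos ½ 0<ε

≤-pointwise : ∀ {x y} → (∀ m → seq x m ℚ.≤ seq y m) → x ≤ y
≤-pointwise {x} {y} x≤y ε 0<ε = 0 , λ m _ → begin
  seq x m          ≤⟨ x≤y m ⟩
  seq y m          ≡⟨ ℚ.+-identityʳ (seq y m) ⟨
  seq y m ℚ.+ 0ℚ   ≤⟨ ℚ.+-monoʳ-≤ (seq y m) (ℚ.<⇒≤ 0<ε) ⟩
  seq y m ℚ.+ ε    ∎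
  where open ℚ.≤-Reasoning

≤-refl : ∀ {x} → x ≤ x
≤-refl {x} = ≤-pointwise {x} {x} λ _ → ℚ.≤-refl

≤-reflexive : ∀ {x y} → x ≡ y → x ≤ y
≤-reflexive {x} refl = ≤-refl {x}

-- Linear arithmetic: an inequality follows from the sum of two others if its
-- two sides differ, pointwise, by as much as the sides of that sum do.

≤-combine : ∀ {a b c d x y} → a ≤ b → c ≤ d →
            (∀ m → seq x m ℚ.- seq y m ≡
                   (seq a m ℚ.+ seq c m) ℚ.- (seq b m ℚ.+ seq d m)) →
            x ≤ y
≤-combine {a} {b} {c} {d} {x} {y} a≤b c≤d sum ε 0<ε
  with M , a≤ ← a≤b (½ ℚ.* ε) (half-pos 0<ε)
     | N , c≤ ← c≤d (½ ℚ.* ε) (half-pos 0<ε)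
  = M ℕ.⊔ N , λ m ≤m → begin
    seq x m
      ≡⟨ solve 2 (λ x y → x := (x :- y) :+ y) refl (seq x m) (seq y m) ⟩
    (seq x m ℚ.- seq y m) ℚ.+ seq y m
      ≡⟨ cong (ℚ._+ seq y m) (sum m) ⟩
    ((seq a m ℚ.+ seq c m) ℚ.- (seq b m ℚ.+ seq d m)) ℚ.+ seq y m
      ≤⟨ ℚ.+-monoˡ-≤ (seq y m) (ℚ.+-monoˡ-≤ (ℚ.- (seq b m ℚ.+ seq d m))
           (ℚ.+-mono-≤ (a≤ m (ℕ.m⊔n≤o⇒m≤o M N ≤m)) (c≤ m (ℕ.m⊔n≤o⇒n≤o M N ≤m)))) ⟩
    ((seq b m ℚ.+ ½ ℚ.* ε ℚ.+ (seq d m ℚ.+ ½ ℚ.* ε)) ℚ.- (seq b m ℚ.+ seq d m)) ℚ.+ seq y m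
      ≡⟨ solve 4 (λ b d h y → ((b :+ h :+ (d :+ h)) :- (b :+ d)) :+ y := y :+ (h :+ h))
           refl (seq b m) (seq d m) (½ ℚ.* ε) (seq y m) ⟩
    seq y m ℚ.+ (½ ℚ.* ε ℚ.+ ½ ℚ.* ε)
      ≡⟨ cong (seq y m ℚ.+_) (trans (sym (ℚ.*-distribʳ-+ ε ½ ½)) (ℚ.*-identityˡ ε)) ⟩
    seq y m ℚ.+ ε ∎
  where
  open ℚ.≤-Reasoning
  open +-*-Solver

≤-trans : ∀ {x y z} → x ≤ y → y ≤ z → x ≤ z
≤-trans {x} {y} {z} x≤y y≤z = ≤-combine {x} {y} {y} {z} {x} {z} x≤y y≤z λ m →
  solve 3 (λ x y z → x :- z := (x :+ y) :- (y :+ z)) refl (seq x m) (seq y m) (seq z m)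
  where open +-*-Solver

+-mono-≤ : ∀ {a b c d} → a ≤ b → c ≤ d → a + c ≤ b + d
+-mono-≤ {a} {b} {c} {d} a≤b c≤d = ≤-combine {a} {b} {c} {d} {a + c} {b + d} a≤b c≤d λ _ → refl

x≤x+δ : ∀ {x δ} → 0ℝ ≤ δ → x ≤ x + δ
x≤x+δ {x} {δ} 0≤δ = ≤-combine {a = 0ℝ} {b = δ} {c = 0ℝ} {d = 0ℝ} {x = x} {y = x + δ} 0≤δ (≤-refl {0ℝ})
  λ m → solve 2 (λ x d → x :- (x :+ d) := (con 0ℚ :+ con 0ℚ) :- (d :+ con 0ℚ))
          refl (seq x m) (seq δ m)
  where open +-*-Solver

close⇒≤ : ∀ a b {δ} → ℚ.∣ a ℚ.- b ∣ ℚ.< δ → a ℚ.≤ b ℚ.+ δ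
close⇒≤ a b {δ} close = begin
  a                ≡⟨ solve 2 (λ a b → a := b :+ (a :- b)) refl a b ⟩
  b ℚ.+ (a ℚ.- b)  ≤⟨ ℚ.+-monoʳ-≤ b (ℚ.≤-trans (p≤∣p∣ (a ℚ.- b)) (ℚ.<⇒≤ close)) ⟩
  b ℚ.+ δ          ∎
  where
  open ℚ.≤-Reasoning
  open +-*-Solver
  p≤∣p∣ : ∀ p → p ℚ.≤ ℚ.∣ p ∣
  p≤∣p∣ p with ℚ.∣p∣≡p∨∣p∣≡-p p
  ... | inj₁ ∣p∣≡p  = ℚ.≤-reflexive (sym ∣p∣≡p)
  ... | inj₂ ∣p∣≡-p = begin
    p             ≡⟨ solve 1 (λ p → p := :- (:- p)) refl p ⟩
    ℚ.- (ℚ.- p)   ≡⟨ cong ℚ.-_ ∣p∣≡-p ⟨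
    ℚ.- ℚ.∣ p ∣   ≤⟨ ℚ.neg-antimono-≤ (ℚ.0≤∣p∣ p) ⟩
    0ℚ            ≤⟨ ℚ.0≤∣p∣ p ⟩
    ℚ.∣ p ∣       ∎

-- Once x and y are known to within ε / 4, comparing them up to ε / 2 shows
-- either y ≤ x up to ε, or x ≤ y outright.

≰⇒≥ : ∀ {x y} → ¬ (x ≤ y) → y ≤ x
≰⇒≥ {x} {y} x≰y ε 0<ε
  with M , close-x ← cauchy x (½ ℚ.* (½ ℚ.* ε)) (half-pos (half-pos 0<ε))
     | N , close-y ← cauchy y (½ ℚ.* (½ ℚ.* ε)) (half-pos (half-pos 0<ε))
  = K , y≤x
  where
  open ℚ.≤-Reasoning
  open +-*-Solver

  K = M ℕ.⊔ N
  δ = ½ ℚ.* (½ ℚ.* ε)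

  M≤ : ∀ {m} → K ℕ.≤ m → M ℕ.≤ m
  M≤ = ℕ.m⊔n≤o⇒m≤o M N
  N≤ : ∀ {m} → K ℕ.≤ m → N ℕ.≤ m
  N≤ = ℕ.m⊔n≤o⇒n≤o M N

  double : ∀ q → ½ ℚ.* q ℚ.+ ½ ℚ.* q ≡ q
  double q = trans (sym (ℚ.*-distribʳ-+ q ½ ½)) (ℚ.*-identityˡ q)

  y≤x : ∀ m → K ℕ.≤ m → seq y m ℚ.≤ seq x m ℚ.+ ε
  y≤x m K≤m with seq y K ℚ.≤? seq x K ℚ.+ (δ ℚ.+ δ)
  ... | yes yK≤xK = begin
    seq y m
      ≤⟨ close⇒≤ (seq y m) (seq y K) (close-y m K (N≤ K≤m) (N≤ ℕ.≤-refl)) ⟩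
    seq y K ℚ.+ δ
      ≤⟨ ℚ.+-monoˡ-≤ δ yK≤xK ⟩
    seq x K ℚ.+ (δ ℚ.+ δ) ℚ.+ δ
      ≤⟨ ℚ.+-monoˡ-≤ δ (ℚ.+-monoˡ-≤ (δ ℚ.+ δ)
           (close⇒≤ (seq x K) (seq x m) (close-x K m (M≤ ℕ.≤-refl) (M≤ K≤m)))) ⟩
    seq x m ℚ.+ δ ℚ.+ (δ ℚ.+ δ) ℚ.+ δ
      ≡⟨ solve 2 (λ x d → x :+ d :+ (d :+ d) :+ d := x :+ ((d :+ d) :+ (d :+ d)))
           refl (seq x m) δ ⟩
    seq x m ℚ.+ ((δ ℚ.+ δ) ℚ.+ (δ ℚ.+ δ))
      ≡⟨ cong (seq x m ℚ.+_) (trans (cong₂ ℚ._+_ (double (½ ℚ.* ε)) (double (½ ℚ.* ε))) (double ε)) ⟩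
    seq x m ℚ.+ ε ∎
  ... | no yK≰xK = contradiction (λ η 0<η → K , λ k K≤k → begin
    seq x k
      ≤⟨ close⇒≤ (seq x k) (seq x K) (close-x k K (M≤ K≤k) (M≤ ℕ.≤-refl)) ⟩
    seq x K ℚ.+ δ
      ≡⟨ solve 2 (λ x d → x :+ d := (x :+ (d :+ d)) :- d) refl (seq x K) δ ⟩
    (seq x K ℚ.+ (δ ℚ.+ δ)) ℚ.- δ
      ≤⟨ ℚ.+-monoˡ-≤ (ℚ.- δ) (ℚ.<⇒≤ (ℚ.≰⇒> yK≰xK)) ⟩
    seq y K ℚ.- δ
      ≤⟨ ℚ.+-monoˡ-≤ (ℚ.- δ) (close⇒≤ (seq y K) (seq y k) (close-y K k (N≤ ℕ.≤-refl) (N≤ K≤k))) ⟩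
    (seq y k ℚ.+ δ) ℚ.- δ
      ≡⟨ solve 2 (λ y d → (y :+ d) :- d := y :+ con 0ℚ) refl (seq y k) δ ⟩
    seq y k ℚ.+ 0ℚ
      ≤⟨ ℚ.+-monoʳ-≤ (seq y k) (ℚ.<⇒≤ 0<η) ⟩
    seq y k ℚ.+ η ∎) x≰y

≤-total : ∀ {x y} → ¬ ¬ (x ≤ y ⊎ y ≤ x)
≤-total {x} {y} ¬total = ¬total (inj₂ (≰⇒≥ {x} {y} λ x≤y → ¬total (inj₁ x≤y)))

x≤4y⇒¼x≤y : ∀ {x y} → x ≤ (y + y) + (y + y) → (+ 1 / 4) · x ≤ y
x≤4y⇒¼x≤y {x} {y} x≤4y ε 0<ε = N , λ m N≤m → begin
  q ℚ.* seq x m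
    ≤⟨ ℚ.*-monoˡ-≤-nonNeg q (bound m N≤m) ⟩
  q ℚ.* ((seq y m ℚ.+ seq y m) ℚ.+ (seq y m ℚ.+ seq y m) ℚ.+ ε)
    ≤⟨ ℚ.*-monoˡ-≤-nonNeg q (ℚ.+-monoʳ-≤ ((seq y m ℚ.+ seq y m) ℚ.+ (seq y m ℚ.+ seq y m)) ε≤4ε) ⟩
  q ℚ.* ((seq y m ℚ.+ seq y m) ℚ.+ (seq y m ℚ.+ seq y m) ℚ.+ ((ε ℚ.+ ε) ℚ.+ (ε ℚ.+ ε)))
    ≡⟨ solve 2 (λ y e → con q :* ((y :+ y) :+ (y :+ y) :+ ((e :+ e) :+ (e :+ e))) := y :+ e)
         refl (seq y m) ε ⟩
  seq y m ℚ.+ ε ∎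
  where
  open ℚ.≤-Reasoning
  open +-*-Solver
  q = + 1 / 4
  N = proj₁ (x≤4y ε 0<ε)
  bound = proj₂ (x≤4y ε 0<ε)
  p≤p+p : ∀ {p} → 0ℚ ℚ.≤ p → p ℚ.≤ p ℚ.+ p
  p≤p+p {p} 0≤p = subst (ℚ._≤ p ℚ.+ p) (ℚ.+-identityʳ p) (ℚ.+-monoʳ-≤ p 0≤p)
  ε≤4ε : ε ℚ.≤ (ε ℚ.+ ε) ℚ.+ (ε ℚ.+ ε)
  ε≤4ε = ℚ.≤-trans (p≤p+p (ℚ.<⇒≤ 0<ε)) (ℚ.+-mono-≤ (p≤p+p (ℚ.<⇒≤ 0<ε)) (p≤p+p (ℚ.<⇒≤ 0<ε)))

-- Finite subsets

private
  variable
    n : ℕ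
    p q s : Subset n

∪-least : p ⊆ s → q ⊆ s → p ∪ q ⊆ s
∪-least {p = p} {q = q} p⊆s q⊆s x∈ = [ p⊆s , q⊆s ]′ (x∈p∪q⁻ p q x∈)

⊆∪ˡ : p ⊆ p ∪ q
⊆∪ˡ {q = q} = p⊆p∪q q

⊆∪ʳ : q ⊆ p ∪ q
⊆∪ʳ {q = q} {p = p} = q⊆p∪q p q

∪-mono : ∀ {p q r s : Subset n} → p ⊆ r → q ⊆ s → p ∪ q ⊆ r ∪ s
∪-mono p⊆r q⊆s = ∪-least (⊆∪ˡ ∘ p⊆r) (⊆∪ʳ ∘ q⊆s)

⁅⁆⊆ : ∀ {x} → x ∈ p → ⁅ x ⁆ ⊆ p
⁅⁆⊆ {p = p} {x} x∈p y∈⁅x⁆ = subst (_∈ p) (sym (x∈⁅y⁆⇒x≡y x y∈⁅x⁆)) x∈p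

x∈p∪⁅x⁆ : ∀ {x} → x ∈ p ∪ ⁅ x ⁆
x∈p∪⁅x⁆ {x = x} = ⊆∪ʳ (x∈⁅x⁆ x)

∪-absorb : q ⊆ p → p ∪ q ≡ p
∪-absorb q⊆p = ⊆-antisym (∪-least ⊆-refl q⊆p) ⊆∪ˡ

⊆∩∁∪ : p ⊆ (p ∩ ∁ q) ∪ q
⊆∩∁∪ {q = q} {x = x} x∈p with x ∈? q
... | yes x∈q = ⊆∪ʳ x∈q
... | no  x∉q = ⊆∪ˡ (x∈p∩q⁺ (x∈p , x∉p⇒x∈∁p x∉q))

∈∩∁⁻ : ∀ {x} → x ∈ p ∩ ∁ q → x ∈ p × x ∉ q
∈∩∁⁻ {p = p} {q = q} x∈ with x∈p , x∈∁q ← x∈p∩q⁻ p (∁ q) x∈ = x∈p , x∈∁p⇒x∉p x∈∁q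

∩∁-antitone : ∀ {p q s : Subset n} → q ⊆ s → p ∩ ∁ s ⊆ p ∩ ∁ q
∩∁-antitone q⊆s x∈ with x∈p , x∉s ← ∈∩∁⁻ x∈ = x∈p∩q⁺ (x∈p , x∉p⇒x∈∁p (x∉s ∘ q⊆s))

∣p∪⁅x⁆∣≡1+∣p∣ : ∀ {p : Subset n} {x} → x ∉ p → ∣ p ∪ ⁅ x ⁆ ∣ ≡ suc ∣ p ∣
∣p∪⁅x⁆∣≡1+∣p∣ {p = outside ∷ p} {zero}  _   = cong (suc ∘ ∣_∣) (∪-identityʳ p)
∣p∪⁅x⁆∣≡1+∣p∣ {p = inside  ∷ p} {zero}  x∉p = contradiction here x∉p
∣p∪⁅x⁆∣≡1+∣p∣ {p = outside ∷ p} {suc x} x∉p = ∣p∪⁅x⁆∣≡1+∣p∣ (x∉p ∘ there)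
∣p∪⁅x⁆∣≡1+∣p∣ {p = inside  ∷ p} {suc x} x∉p = cong suc (∣p∪⁅x⁆∣≡1+∣p∣ (x∉p ∘ there))

-- A subset of p that is smaller by at most one element omits at most one
-- element of p.

omits-at-most-one : q ⊆ p → ∣ p ∣ ℕ.≤ suc ∣ q ∣ →
                    p ⊆ q ⊎ ∃ λ y → y ∈ p × y ∉ q × p ⊆ q ∪ ⁅ y ⁆
omits-at-most-one {q = q} {p = p} q⊆p ∣p∣≤ with nonempty? (p ∩ ∁ q)
... | no  empty = inj₁ λ x∈p → [ (λ x∈ → contradiction (_ , x∈) empty) , id ]′
                                 (x∈p∪q⁻ (p ∩ ∁ q) q (⊆∩∁∪ x∈p))
... | yes (y , y∈) = inj₂ (y , y∈p , y∉q , covers)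
  where
  y∈p = proj₁ (∈∩∁⁻ {p = p} {q = q} y∈)
  y∉q = proj₂ (∈∩∁⁻ {p = p} {q = q} y∈)
  covers : p ⊆ q ∪ ⁅ y ⁆
  covers {x} x∈p with x ∈? (q ∪ ⁅ y ⁆)
  ... | yes x∈ = x∈
  ... | no  x∉ = contradiction (ℕ.<-≤-trans (p⊂q⇒∣p∣<∣q∣ (∪-least q⊆p (⁅⁆⊆ y∈p) , x , x∈p , x∉))
                   (subst (∣ p ∣ ℕ.≤_) (sym (∣p∪⁅x⁆∣≡1+∣p∣ y∉q)) ∣p∣≤)) (ℕ.<-irrefl refl)

-- Marginal gains of a submodular function

module _ {n : ℕ} (f : Subset n → ℝ) where

  -- The marginal gain f (u ∣ S), written as the program computes it.

  gain : Subset n → Fin n → ℝ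
  gain S u = f (S ∪ ⁅ u ⁆) - f S

module _ {n : ℕ} (f : Subset n → ℝ) (submodular : Submodular f) where

  open +-*-Solver

  -- An upper bound on a marginal gain persists under enlarging the base set.

  diminishing : ∀ {S T u δ} → S ⊆ T → u ∉ T → gain f S u ≤ δ → f (T ∪ ⁅ u ⁆) ≤ f T + δ
  diminishing {S} {T} {u} {δ} S⊆T u∉T gain≤δ =
    ≤-combine {a = f (T ∪ ⁅ u ⁆) + f S} {b = f (S ∪ ⁅ u ⁆) + f T} {c = gain f S u} {d = δ}
      {x = f (T ∪ ⁅ u ⁆)} {y = f T + δ}
      (subst₂ (λ A B → f A + f B ≤ f (S ∪ ⁅ u ⁆) + f T) union intersection
        (submodular (S ∪ ⁅ u ⁆) T))
      gain≤δ
      λ m → solve 5 (λ Tu S Su T d → Tu :- (T :+ d) := ((Tu :+ S) :+ (Su :- S)) :- ((Su :+ T) :+ d))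
        refl (seq (f (T ∪ ⁅ u ⁆)) m) (seq (f S) m) (seq (f (S ∪ ⁅ u ⁆)) m) (seq (f T) m) (seq δ m)
    where
    union : (S ∪ ⁅ u ⁆) ∪ T ≡ T ∪ ⁅ u ⁆
    union = ⊆-antisym (∪-least (∪-mono S⊆T ⊆-refl) ⊆∪ˡ)
                      (∪-least ⊆∪ʳ (⊆∪ˡ ∘ ⊆∪ʳ))
    intersection : (S ∪ ⁅ u ⁆) ∩ T ≡ S
    intersection = ⊆-antisym
      (λ x∈ → let x∈Su , x∈T = x∈p∩q⁻ (S ∪ ⁅ u ⁆) T x∈ in
        [ id , (λ x∈u → contradiction (subst (_∈ T) (x∈⁅y⁆⇒x≡y u x∈u) x∈T) u∉T) ]′
          (x∈p∪q⁻ S ⁅ u ⁆ x∈Su))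
      (λ x∈S → x∈p∩q⁺ (⊆∪ˡ x∈S , S⊆T x∈S))

  -- Adding to T a set of elements whose gains at S ⊆ T are nonpositive does
  -- not increase the value.

  nonpositive-gains : ∀ {S} A → (∀ {x} → x ∈ A → gain f S x ≤ 0ℝ) →
                      ∀ {T} → S ⊆ T → f (T ∪ A) ≤ f T
  nonpositive-gains {S} A = go A (⊂-wellFounded A)
    where
    go : ∀ A → Acc _ A → (∀ {x} → x ∈ A → gain f S x ≤ 0ℝ) → ∀ {T} → S ⊆ T → f (T ∪ A) ≤ f T
    go A (acc smaller) gain≤0 {T} S⊆T with nonempty? (A ∩ ∁ T)
    ... | no empty = ≤-reflexive (cong f (∪-absorb λ x∈A →
            [ (λ x∈ → contradiction (_ , x∈) empty) , id ]′ (x∈p∪q⁻ (A ∩ ∁ T) T (⊆∩∁∪ x∈A))))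
    ... | yes (y , y∈) with y∈A , y∉T ← ∈∩∁⁻ {p = A} {q = T} y∈ =
      ≤-trans {f (T ∪ A)} {f (T ∪ ⁅ y ⁆)} {f T}
        (subst (λ B → f B ≤ f (T ∪ ⁅ y ⁆)) regroup
          (go (A without y) (smaller (x∈p⇒p-x⊂p y∈A)) (gain≤0 ∘ p─q⊆p A ⁅ y ⁆) (⊆∪ˡ ∘ S⊆T)))
        (≤-trans {f (T ∪ ⁅ y ⁆)} {f T + 0ℝ} {f T}
          (diminishing {δ = 0ℝ} S⊆T y∉T (gain≤0 y∈A))
          (≤-pointwise {f T + 0ℝ} {f T} λ m → ℚ.≤-reflexive (ℚ.+-identityʳ _)))
      where
      regroup : (T ∪ ⁅ y ⁆) ∪ (A without y) ≡ T ∪ A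
      regroup = ⊆-antisym
        (∪-least (∪-mono ⊆-refl (⁅⁆⊆ (proj₁ (∈∩∁⁻ {p = A} {q = T} y∈)))) (⊆∪ʳ ∘ p─q⊆p A ⁅ y ⁆))
        (∪-least (⊆∪ˡ ∘ ⊆∪ˡ) A⊆)
        where
        A⊆ : A ⊆ (T ∪ ⁅ y ⁆) ∪ (A without y)
        A⊆ {x} x∈A with x ∈? ⁅ y ⁆
        ... | yes x∈⁅y⁆ = ⊆∪ˡ (⊆∪ʳ x∈⁅y⁆)
        ... | no  x∉⁅y⁆ = ⊆∪ʳ (x∈p∧x∉q⇒x∈p─q x∈A x∉⁅y⁆)

-- Augmentation in a matroid

module _ {n : ℕ} (M : Matroid n) where

  -- An independent set A can be enlarged by elements of B to an independent
  -- set at least as large as B.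

  augment : ∀ {A B} → Independent M A → Independent M B →
            ∃ λ C → A ⊆ C × C ⊆ A ∪ B × Independent M C × ∣ B ∣ ℕ.≤ ∣ C ∣
  augment {A} {B} A-ind B-ind = grow ∣ B ∣ A ⊆-refl ⊆∪ˡ A-ind (ℕ.m≤n+m ∣ B ∣ ∣ A ∣)
    where
    grow : ∀ k C → A ⊆ C → C ⊆ A ∪ B → Independent M C → ∣ B ∣ ℕ.≤ ∣ C ∣ ℕ.+ k →
           ∃ λ C → A ⊆ C × C ⊆ A ∪ B × Independent M C × ∣ B ∣ ℕ.≤ ∣ C ∣
    grow zero C A⊆C C⊆ C-ind ∣B∣≤ =
      C , A⊆C , C⊆ , C-ind , subst (∣ B ∣ ℕ.≤_) (ℕ.+-identityʳ ∣ C ∣) ∣B∣≤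
    grow (suc k) C A⊆C C⊆ C-ind ∣B∣≤ with ∣ C ∣ ℕ.<? ∣ B ∣
    ... | no  ∣C∣≮∣B∣ = C , A⊆C , C⊆ , C-ind , ℕ.≮⇒≥ ∣C∣≮∣B∣
    ... | yes ∣C∣<∣B∣ with x , x∈B , x∉C , Cx-ind ← exchange M C-ind B-ind ∣C∣<∣B∣ =
      grow k (C ∪ ⁅ x ⁆) (⊆∪ˡ ∘ A⊆C) (∪-least C⊆ (⁅⁆⊆ (⊆∪ʳ x∈B))) Cx-ind
        (subst (∣ B ∣ ℕ.≤_)
          (trans (ℕ.+-suc ∣ C ∣ k) (cong (ℕ._+ k) (sym (∣p∪⁅x⁆∣≡1+∣p∣ x∉C)))) ∣B∣≤)

  -- Inserting e into an independent set S ∪ A costs at most one element of A: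
  -- an augmentation of S ∪ {e} from S ∪ A is smaller than S ∪ A ∪ {e} by at
  -- most one element.

  exchange-one : ∀ {S A e} → Independent M (S ∪ A) → Independent M (S ∪ ⁅ e ⁆) →
                 Independent M ((S ∪ ⁅ e ⁆) ∪ A) ⊎
                 ∃ λ y → y ∈ A × Independent M ((S ∪ ⁅ e ⁆) ∪ (A ∩ ∁ ⁅ y ⁆))
  exchange-one {S} {A} {e} SA-ind Se-ind
    with C , Se⊆C , C⊆ , C-ind , ∣SA∣≤∣C∣ ← augment Se-ind SA-ind
    with omits-at-most-one {q = C} {p = (S ∪ A) ∪ ⁅ e ⁆} C⊆SAe (ℕ.≤-trans ∣SAe∣≤ (ℕ.s≤s ∣SA∣≤∣C∣))
    where
    C⊆SAe : C ⊆ (S ∪ A) ∪ ⁅ e ⁆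
    C⊆SAe = ∪-least (∪-mono ⊆∪ˡ ⊆-refl) ⊆∪ˡ ∘ C⊆
    ∣SAe∣≤ : ∣ (S ∪ A) ∪ ⁅ e ⁆ ∣ ℕ.≤ suc ∣ S ∪ A ∣
    ∣SAe∣≤ with e ∈? (S ∪ A)
    ... | yes e∈ = ℕ.m≤n⇒m≤1+n (ℕ.≤-reflexive (cong ∣_∣ (∪-absorb (⁅⁆⊆ e∈))))
    ... | no  e∉ = ℕ.≤-reflexive (∣p∪⁅x⁆∣≡1+∣p∣ e∉)
  ... | inj₁ SAe⊆C = inj₁ (hereditary M (∪-least Se⊆C (SAe⊆C ∘ ⊆∪ˡ ∘ ⊆∪ʳ)) C-ind)
  ... | inj₂ (y , y∈ , y∉C , SAe⊆Cy) = inj₂ (y , y∈A , hereditary M (∪-least Se⊆C A⊆C) C-ind)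
    where
    y∈A : y ∈ A
    y∈A with x∈p∪q⁻ (S ∪ A) ⁅ e ⁆ y∈
    ... | inj₂ y∈e = contradiction (Se⊆C (⊆∪ʳ y∈e)) y∉C
    ... | inj₁ y∈SA with x∈p∪q⁻ S A y∈SA
    ...   | inj₁ y∈S = contradiction (Se⊆C (⊆∪ˡ y∈S)) y∉C
    ...   | inj₂ y∈A = y∈A
    A⊆C : A ∩ ∁ ⁅ y ⁆ ⊆ C
    A⊆C x∈ with x∈A , x∉y ← ∈∩∁⁻ x∈ =
      [ id , (λ x∈y → contradiction x∈y x∉y) ]′ (x∈p∪q⁻ C ⁅ y ⁆ (SAe⊆Cy (⊆∪ˡ (⊆∪ʳ x∈A))))

-- Charging an independent set against the two greedy sets

module _ {n : ℕ} (M : Matroid n) where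

  -- T is S together with the elements of O that have been charged on the
  -- side of S, where S′ is the other greedy set.  The uncharged elements
  -- O ∩ ∁ T lie in neither greedy set and can all be added to S at once.

  record Cover (O S S′ T : Subset n) : Set where
    field
      base   : S ⊆ T
      within : T ⊆ S ∪ O
      taken  : S′ ∩ O ⊆ T
      spare  : Independent M (S ∪ (O ∩ ∁ T))

  open Cover

  module _ (f : Subset n → ℝ) where

    -- The amortized bound: the sets charged on the two sides are worth at most
    -- 2 (f S + f S′) together.

    Charged : Subset n → Subset n → Subset n → Set
    Charged O S S′ = ∃ λ T → ∃ λ T′ → Cover O S S′ T × Cover O S′ S T′ ×
      f T + f T′ ≤ (f S + f S′) + (f S + f S′)

    charged-sym : ∀ {O S S′} → Charged O S S′ → Charged O S′ S
    charged-sym {O} {S} {S′} (T , T′ , cover , cover′ , bound) =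
      T′ , T , cover′ , cover ,
      ≤-combine {a = f T + f T′} {b = (f S + f S′) + (f S + f S′)} {c = 0ℝ} {d = 0ℝ}
        {x = f T′ + f T} {y = (f S′ + f S) + (f S′ + f S)} bound (≤-refl {0ℝ})
        λ m → solve 4 (λ T T′ S S′ → (T′ :+ T) :- ((S′ :+ S) :+ (S′ :+ S)) :=
                ((T :+ T′) :+ con 0ℚ) :- (((S :+ S′) :+ (S :+ S′)) :+ con 0ℚ))
                refl (seq (f T) m) (seq (f T′) m) (seq (f S) m) (seq (f S′) m)
      where open +-*-Solver

    charged-⊥ : ∀ {O} → NonNegative f → Independent M O → Charged O ⊥ ⊥
    charged-⊥ {O} nonneg O-ind = ⊥ , ⊥ , cover , cover , bound
      where
      open +-*-Solver
      cover : Cover O ⊥ ⊥ ⊥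
      cover .base   = id
      cover .within = ⊆∪ˡ
      cover .taken  = p∩q⊆p ⊥ O
      cover .spare  = hereditary M (∪-least ⊥⊆ (p∩q⊆p O (∁ ⊥))) O-ind
      bound : f ⊥ + f ⊥ ≤ (f ⊥ + f ⊥) + (f ⊥ + f ⊥)
      bound = ≤-combine {a = 0ℝ} {b = f ⊥} {c = 0ℝ} {d = f ⊥}
        {x = f ⊥ + f ⊥} {y = (f ⊥ + f ⊥) + (f ⊥ + f ⊥)} (nonneg ⊥) (nonneg ⊥)
        λ m → solve 1 (λ b → (b :+ b) :- ((b :+ b) :+ (b :+ b)) :=
                (con 0ℚ :+ con 0ℚ) :- (b :+ b)) refl (seq (f ⊥) m)

    -- T can be enlarged by elements of O, at a total cost of at most δ, such
    -- that the elements of O that remain outside are compatible with S ∪ {e}.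

    Released : Subset n → Subset n → Subset n → Fin n → ℝ → Set
    Released O S T e δ = ∃ λ R → T ⊆ R × R ⊆ T ∪ O ×
      Independent M ((S ∪ ⁅ e ⁆) ∪ (O ∩ ∁ R)) × f R ≤ f T + δ

    release : ∀ {O S T e δ} → 0ℝ ≤ δ →
              Independent M (S ∪ (O ∩ ∁ T)) → Independent M (S ∪ ⁅ e ⁆) →
              (∀ {y} → y ∈ O → y ∉ T → f (T ∪ ⁅ y ⁆) ≤ f T + δ) →
              Released O S T e δ
    release {O} {S} {T} {e} {δ} 0≤δ spare-ind Se-ind cost
      with exchange-one M spare-ind Se-ind
    ... | inj₁ ind = T , ⊆-refl , ⊆∪ˡ , ind , x≤x+δ {f T} {δ} 0≤δ
    ... | inj₂ (y , y∈ , ind) with y∈O , y∉T ← ∈∩∁⁻ {p = O} {q = T} y∈ =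
      T ∪ ⁅ y ⁆ , ⊆∪ˡ , ∪-mono ⊆-refl (⁅⁆⊆ y∈O) ,
      hereditary M (∪-mono ⊆-refl remaining) ind ,
      cost y∈O y∉T
      where
      remaining : O ∩ ∁ (T ∪ ⁅ y ⁆) ⊆ (O ∩ ∁ T) ∩ ∁ ⁅ y ⁆
      remaining x∈ with x∈O , x∉ ← ∈∩∁⁻ {p = O} {q = T ∪ ⁅ y ⁆} x∈ =
        x∈p∩q⁺ (x∈p∩q⁺ (x∈O , x∉p⇒x∈∁p (x∉ ∘ ⊆∪ˡ)) , x∉p⇒x∈∁p (x∉ ∘ ⊆∪ʳ))

    module _ (submodular : Submodular f) where

      -- The uncharged elements are candidates for S, so a bound on the gains
      -- of all candidates bounds the cost of charging one of them.

      charge-cost : ∀ {O S S′ T R δ} → Cover O S S′ T →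
                    (∀ {u} → u ∉ S → u ∉ S′ → Independent M (S ∪ ⁅ u ⁆) → gain f S u ≤ δ) →
                    ∀ {y} → y ∈ O → T ⊆ R → y ∉ R → f (R ∪ ⁅ y ⁆) ≤ f R + δ
      charge-cost {O} {S} {S′} {T} {R} {δ} cover max {y} y∈O T⊆R y∉R =
        diminishing f submodular {δ = δ} (T⊆R ∘ base cover) y∉R
          (max (y∉T ∘ base cover)
               (λ y∈S′ → y∉T (taken cover (x∈p∩q⁺ (y∈S′ , y∈O))))
               (hereditary M
                 (∪-mono ⊆-refl (⁅⁆⊆ (x∈p∩q⁺ (y∈O , x∉p⇒x∈∁p y∉T))))
                 (spare cover)))
        where
        y∉T : y ∉ T
        y∉T = y∉R ∘ T⊆R

      -- A greedy addition of e to S, of gain δ, x≤x+δs the right-hand side of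
      -- the charging bound by 2 δ.  The left-hand side pays at most δ for each
      -- of: e entering T, a further element entering T to release the rest,
      -- and e entering T′.  One of the three is always free: the second if
      -- e ∈ O is uncharged on the side of S, the first if e ∈ O is already
      -- charged there, and the third if e ∉ O.

      charged-grow : ∀ {O S S′ e} → Charged O S S′ → e ∉ S → e ∉ S′ →
        Independent M (S ∪ ⁅ e ⁆) → 0ℝ ≤ gain f S e →
        (∀ {u} → u ∉ S → u ∉ S′ → Independent M (S  ∪ ⁅ u ⁆) → gain f S  u ≤ gain f S e) →
        (∀ {u} → u ∉ S → u ∉ S′ → Independent M (S′ ∪ ⁅ u ⁆) → gain f S′ u ≤ gain f S e) →
        Charged O (S ∪ ⁅ e ⁆) S′
      charged-grow {O} {S} {S′} {e} (T , T′ , cover , cover′ , bound) e∉S e∉S′ Se-ind 0≤δ max max′ =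
        by-cases (e ∈? O) (e ∈? T)
        where
        open +-*-Solver
        δ = gain f S e
        S₊ = S ∪ ⁅ e ⁆

        Se⊆ : ∀ {R} → T ⊆ R → e ∈ R → S₊ ⊆ R
        Se⊆ T⊆R e∈R = ∪-least (T⊆R ∘ base cover) (⁅⁆⊆ e∈R)

        T⊆S₊∪O : T ⊆ S₊ ∪ O
        T⊆S₊∪O = ∪-mono ⊆∪ˡ ⊆-refl ∘ within cover

        total : ∀ {R R′} → f R + f R′ ≤ (f T + f T′) + (δ + δ) →
                f R + f R′ ≤ (f S₊ + f S′) + (f S₊ + f S′)
        total {R} {R′} growth = ≤-combine
          {a = f R + f R′} {b = (f T + f T′) + (δ + δ)}
          {c = f T + f T′} {d = (f S + f S′) + (f S + f S′)}
          {x = f R + f R′} {y = (f S₊ + f S′) + (f S₊ + f S′)}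
          growth bound
          λ m → solve 7 (λ r r′ t t′ s s′ s₊ →
              (r :+ r′) :- ((s₊ :+ s′) :+ (s₊ :+ s′)) :=
              ((r :+ r′) :+ (t :+ t′)) :-
              (((t :+ t′) :+ ((s₊ :- s) :+ (s₊ :- s))) :+ ((s :+ s′) :+ (s :+ s′))))
            refl (seq (f R) m) (seq (f R′) m) (seq (f T) m) (seq (f T′) m)
                 (seq (f S) m) (seq (f S′) m) (seq (f S₊) m)

        one-each : ∀ {R R′} → f R ≤ f T + δ → f R′ ≤ f T′ + δ →
                   f R + f R′ ≤ (f T + f T′) + (δ + δ)
        one-each {R} {R′} fR≤ fR′≤ = ≤-combine
          {a = f R} {b = f T + δ} {c = f R′} {d = f T′ + δ}
          {x = f R + f R′} {y = (f T + f T′) + (δ + δ)} fR≤ fR′≤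
          λ m → solve 5 (λ r r′ t t′ d →
              (r :+ r′) :- ((t :+ t′) :+ (d :+ d)) := (r :+ r′) :- ((t :+ d) :+ (t′ :+ d)))
            refl (seq (f R) m) (seq (f R′) m) (seq (f T) m) (seq (f T′) m) (seq δ m)

        -- On the side of S′, e is charged if it belongs to O.
        R₀′ = T′ ∪ ⁅ e ⁆

        cover₀′ : e ∈ O → Cover O S′ S₊ R₀′
        cover₀′ e∈O .base   = ⊆∪ˡ ∘ base cover′
        cover₀′ e∈O .within = ∪-least (within cover′) (⁅⁆⊆ (⊆∪ʳ e∈O))
        cover₀′ e∈O .taken x∈ with x∈S₊ , x∈O ← x∈p∩q⁻ S₊ O x∈ with x∈p∪q⁻ S ⁅ e ⁆ x∈S₊
        ... | inj₁ x∈S = ⊆∪ˡ (taken cover′ (x∈p∩q⁺ (x∈S , x∈O)))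
        ... | inj₂ x∈e = ⊆∪ʳ x∈e
        cover₀′ e∈O .spare = hereditary M (∪-mono ⊆-refl (∩∁-antitone ⊆∪ˡ)) (spare cover′)

        cost₀′ : e ∈ O → f R₀′ ≤ f T′ + δ
        cost₀′ e∈O with e ∈? T′
        ... | yes e∈T′ = subst (λ R → f R ≤ f T′ + δ) (sym (∪-absorb (⁅⁆⊆ e∈T′)))
                           (x≤x+δ {f T′} {δ} 0≤δ)
        ... | no  e∉T′ = charge-cost {δ = δ} cover′ (λ u∉S′ u∉S → max′ u∉S u∉S′) e∈O ⊆-refl e∉T′

        by-cases : Dec (e ∈ O) → Dec (e ∈ T) → Charged O S₊ S′
        by-cases (yes e∈O) (no e∉T) =
          T ∪ ⁅ e ⁆ , R₀′ , cover₊ , cover₀′ e∈O ,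
          total (one-each (diminishing f submodular {δ = δ} (base cover) e∉T (≤-refl {δ})) (cost₀′ e∈O))
          where
          cover₊ : Cover O S₊ S′ (T ∪ ⁅ e ⁆)
          cover₊ .base   = Se⊆ ⊆∪ˡ x∈p∪⁅x⁆
          cover₊ .within = ∪-least T⊆S₊∪O (⊆∪ˡ ∘ ⊆∪ʳ)
          cover₊ .taken  = ⊆∪ˡ ∘ taken cover
          cover₊ .spare  = hereditary M
            (∪-least (∪-mono ⊆-refl (⁅⁆⊆ (x∈p∩q⁺ (e∈O , x∉p⇒x∈∁p e∉T))))
                     (⊆∪ʳ ∘ ∩∁-antitone ⊆∪ˡ))
            (spare cover)
        by-cases (yes e∈O) (yes e∈T) = charge
          (release {O} {S} {T} {e} {δ} 0≤δ (spare cover) Se-ind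
            (λ y∈O → charge-cost {O} {S} {S′} {T} {T} {δ} cover max y∈O ⊆-refl))
          where
          charge : Released O S T e δ → Charged O S₊ S′
          charge (R , T⊆R , R⊆ , R-spare , cost) =
            R , R₀′ ,
            record { base = Se⊆ T⊆R (T⊆R e∈T) ; within = ∪-least T⊆S₊∪O ⊆∪ʳ ∘ R⊆
                   ; taken = T⊆R ∘ taken cover ; spare = R-spare } ,
            cover₀′ e∈O , total {R} {R₀′} (one-each {R} {R₀′} cost (cost₀′ e∈O))
        by-cases (no e∉O) _ = charge
          (release {O} {S} {T ∪ ⁅ e ⁆} {e} {δ} 0≤δ
            (hereditary M (∪-mono ⊆-refl (∩∁-antitone ⊆∪ˡ)) (spare cover)) Se-ind
            (λ y∈O → charge-cost {O} {S} {S′} {T} {T ∪ ⁅ e ⁆} {δ} cover max y∈O ⊆∪ˡ))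
          where
          e∉T : e ∉ T
          e∉T e∈T = [ e∉S , e∉O ]′ (x∈p∪q⁻ S O (within cover e∈T))
          taken′ : S₊ ∩ O ⊆ T′
          taken′ x∈ with x∈S₊ , x∈O ← x∈p∩q⁻ S₊ O x∈ with x∈p∪q⁻ S ⁅ e ⁆ x∈S₊
          ... | inj₁ x∈S = taken cover′ (x∈p∩q⁺ (x∈S , x∈O))
          ... | inj₂ x∈e = contradiction (subst (_∈ O) (x∈⁅y⁆⇒x≡y e x∈e) x∈O) e∉O
          charge : Released O S (T ∪ ⁅ e ⁆) e δ → Charged O S₊ S′
          charge (R , T⊆R , R⊆ , R-spare , cost) =
            R , T′ ,
            record { base = Se⊆ (T⊆R ∘ ⊆∪ˡ) (T⊆R x∈p∪⁅x⁆)
                   ; within = ∪-least (∪-least T⊆S₊∪O (⊆∪ˡ ∘ ⊆∪ʳ)) ⊆∪ʳ ∘ R⊆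
                   ; taken = T⊆R ∘ ⊆∪ˡ ∘ taken cover ; spare = R-spare } ,
            record { base = base cover′ ; within = within cover′ ; taken = taken′
                   ; spare = spare cover′ } ,
            total {R} {T′} (≤-combine
              {a = f R} {b = f (T ∪ ⁅ e ⁆) + δ} {c = f (T ∪ ⁅ e ⁆)} {d = f T + δ}
              {x = f R + f T′} {y = (f T + f T′) + (δ + δ)}
              cost (diminishing f submodular {S} {T} {e} {δ} (base cover) e∉T (≤-refl {δ}))
              λ m → solve 5 (λ r te t t′ d →
                  (r :+ t′) :- ((t :+ t′) :+ (d :+ d)) := (r :+ te) :- ((te :+ d) :+ (t :+ d)))
                refl (seq (f R) m) (seq (f (T ∪ ⁅ e ⁆)) m) (seq (f T) m) (seq (f T′) m) (seq δ m))

      -- When no candidate for S has positive gain, the uncharged elements of O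
      -- are worth nothing to S.

      cover-bound : ∀ {O S S′ T} → Cover O S S′ T →
        (∀ {u} → u ∉ S → u ∉ S′ → Independent M (S ∪ ⁅ u ⁆) → gain f S u ≤ 0ℝ) →
        f (S ∪ O) ≤ f T
      cover-bound {O} {S} {S′} {T} cover max =
        subst (λ A → f A ≤ f T) union
          (nonpositive-gains f submodular (O ∩ ∁ T) gain≤0 (base cover))
        where
        gain≤0 : ∀ {x} → x ∈ O ∩ ∁ T → gain f S x ≤ 0ℝ
        gain≤0 x∈ with x∈O , x∉T ← ∈∩∁⁻ {p = O} {q = T} x∈ =
          max (x∉T ∘ base cover) (λ x∈S′ → x∉T (taken cover (x∈p∩q⁺ (x∈S′ , x∈O))))
              (hereditary M (∪-mono ⊆-refl (⁅⁆⊆ x∈)) (spare cover))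
        union : T ∪ (O ∩ ∁ T) ≡ S ∪ O
        union = ⊆-antisym (∪-least (within cover) (⊆∪ʳ ∘ p∩q⊆p O (∁ T)))
                          (∪-least (⊆∪ˡ ∘ base cover) (∪-least ⊆∪ʳ ⊆∪ˡ ∘ ⊆∩∁∪))

      -- Since S and S′ are disjoint, f (S ∪ O) + f (S′ ∪ O) is at least f O.

      charged-bound : ∀ {O S S′} → NonNegative f → (∀ {x} → x ∈ S → x ∉ S′) → Charged O S S′ →
        (∀ {u} → u ∉ S → u ∉ S′ → Independent M (S  ∪ ⁅ u ⁆) → gain f S  u ≤ 0ℝ) →
        (∀ {u} → u ∉ S → u ∉ S′ → Independent M (S′ ∪ ⁅ u ⁆) → gain f S′ u ≤ 0ℝ) →
        f O ≤ (f S + f S′) + (f S + f S′)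
      charged-bound {O} {S} {S′} nonneg disjoint (T , T′ , cover , cover′ , bound) max max′ =
        ≤-trans {f O} {f T + f T′} {(f S + f S′) + (f S + f S′)}
          (≤-trans {f O} {f (S ∪ O) + f (S′ ∪ O)} {f T + f T′}
            (≤-combine {a = f ((S ∪ O) ∪ (S′ ∪ O)) + f O} {b = f (S ∪ O) + f (S′ ∪ O)}
              {c = 0ℝ} {d = f ((S ∪ O) ∪ (S′ ∪ O))} {x = f O} {y = f (S ∪ O) + f (S′ ∪ O)}
              (subst (λ A → f ((S ∪ O) ∪ (S′ ∪ O)) + f A ≤ f (S ∪ O) + f (S′ ∪ O)) intersection
                (submodular (S ∪ O) (S′ ∪ O)))
              (nonneg ((S ∪ O) ∪ (S′ ∪ O)))
              λ m → solve 4 (λ o s s′ u → o :- (s :+ s′) := ((u :+ o) :+ con 0ℚ) :- ((s :+ s′) :+ u))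
                refl (seq (f O) m) (seq (f (S ∪ O)) m) (seq (f (S′ ∪ O)) m)
                     (seq (f ((S ∪ O) ∪ (S′ ∪ O))) m))
            (+-mono-≤ {f (S ∪ O)} {f T} {f (S′ ∪ O)} {f T′}
              (cover-bound cover max) (cover-bound cover′ (λ u∉S′ u∉S → max′ u∉S u∉S′))))
          bound
        where
        open +-*-Solver
        intersection : (S ∪ O) ∩ (S′ ∪ O) ≡ O
        intersection = ⊆-antisym ⊆O (λ x∈O → x∈p∩q⁺ (⊆∪ʳ x∈O , ⊆∪ʳ x∈O))
          where
          ⊆O : (S ∪ O) ∩ (S′ ∪ O) ⊆ O
          ⊆O x∈ with x∈SO , x∈S′O ← x∈p∩q⁻ (S ∪ O) (S′ ∪ O) x∈
            with x∈p∪q⁻ S O x∈SO | x∈p∪q⁻ S′ O x∈S′O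
          ... | inj₂ x∈O | _         = x∈O
          ... | inj₁ _   | inj₂ x∈O  = x∈O
          ... | inj₁ x∈S | inj₁ x∈S′ = contradiction x∈S′ (disjoint x∈S)

-- Greedy sequences

-- Adding u to the j-th set of the pair is a possible move.

IsCandidate : Matroid n → Twins {n} → Fin 2 → Fin n → Set
IsCandidate M S j u = u ∉ lookup S zero × u ∉ lookup S (suc zero) ×
                      Independent M (lookup S j ∪ ⁅ u ⁆)

module _ {n : ℕ} (M : Matroid n) (f : Subset n → ℝ) where

  -- Adding e to the i-th set is a move that the algorithm may make from S.
  -- Its gain is only required to be nonnegative: strict positivity does not
  -- follow constructively from the failed test for being at most 0.

  record GreedyChoice (S : Twins) (i : Fin 2) (e : Fin n) : Set where
    field
      isCandidate : IsCandidate M S i e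
      gain≥0      : 0ℝ ≤ gain f (lookup S i) e
      isMaximal   : ∀ j u → IsCandidate M S j u → gain f (lookup S j) u ≤ gain f (lookup S i) e

  open GreedyChoice

  -- The stopping condition, which also covers the absence of candidates.

  Exhausted : Twins → Set
  Exhausted S = ∀ j u → IsCandidate M S j u → gain f (lookup S j) u ≤ 0ℝ

  -- The pairs that are reached by k greedy additions.

  data Greedy : ℕ → Twins → Set where
    start : Greedy 0 (⊥ ∷ ⊥ ∷ [])
    grow  : ∀ {k S i e} → Greedy k S → GreedyChoice S i e →
            Greedy (suc k) (S [ i ]≔ (lookup S i ∪ ⁅ e ⁆))

  greedy-independent : ∀ {k S} → Greedy k S → ∀ j → Independent M (lookup S j)
  greedy-independent start zero       = ⊥-independent M
  greedy-independent start (suc zero) = ⊥-independent M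
  greedy-independent (grow {S = _ ∷ _ ∷ []} {zero} g c) zero = proj₂ (proj₂ (isCandidate c))
  greedy-independent (grow {S = _ ∷ _ ∷ []} {zero} g c) (suc zero) = greedy-independent g (suc zero)
  greedy-independent (grow {S = _ ∷ _ ∷ []} {suc zero} g c) zero = greedy-independent g zero
  greedy-independent (grow {S = _ ∷ _ ∷ []} {suc zero} g c) (suc zero) = proj₂ (proj₂ (isCandidate c))

  greedy-disjoint : ∀ {k S₁ S₂} → Greedy k (S₁ ∷ S₂ ∷ []) → ∀ {x} → x ∈ S₁ → x ∉ S₂
  greedy-disjoint g = go g
    where
    go : ∀ {k S} → Greedy k S → ∀ {x} → x ∈ lookup S zero → x ∉ lookup S (suc zero)
    go start _ x∈⊥ = ∉⊥ x∈⊥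
    go (grow {S = S₁ ∷ S₂ ∷ []} {zero} {e} g c) x∈ with x∈p∪q⁻ S₁ ⁅ e ⁆ x∈
    ... | inj₁ x∈S₁ = go g x∈S₁
    ... | inj₂ x∈e  = subst (_∉ S₂) (sym (x∈⁅y⁆⇒x≡y e x∈e)) (proj₁ (proj₂ (isCandidate c)))
    go (grow {S = S₁ ∷ S₂ ∷ []} {suc zero} {e} g c) x∈S₁ x∈ with x∈p∪q⁻ S₂ ⁅ e ⁆ x∈
    ... | inj₁ x∈S₂ = go g x∈S₁ x∈S₂
    ... | inj₂ x∈e  = proj₁ (isCandidate c) (subst (_∈ S₁) (x∈⁅y⁆⇒x≡y e x∈e) x∈S₁)

  greedy-size : ∀ {k S} → Greedy k S → ∣ lookup S zero ∣ ℕ.+ ∣ lookup S (suc zero) ∣ ≡ k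
  greedy-size start = cong₂ ℕ._+_ (∣⊥∣≡0 n) (∣⊥∣≡0 n)
  greedy-size (grow {S = S₁ ∷ S₂ ∷ []} {zero} {e} g c) =
    trans (cong (ℕ._+ ∣ S₂ ∣) (∣p∪⁅x⁆∣≡1+∣p∣ (proj₁ (isCandidate c)))) (cong suc (greedy-size g))
  greedy-size (grow {S = S₁ ∷ S₂ ∷ []} {suc zero} {e} g c) =
    trans (cong (∣ S₁ ∣ ℕ.+_) (∣p∪⁅x⁆∣≡1+∣p∣ (proj₁ (proj₂ (isCandidate c)))))
          (trans (ℕ.+-suc ∣ S₁ ∣ ∣ S₂ ∣) (cong suc (greedy-size g)))

  greedy-length : ∀ {r} → (∀ S → Independent M S → ∣ S ∣ ℕ.≤ r) →
                  ∀ {k S} → Greedy k S → k ℕ.≤ r ℕ.+ r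
  greedy-length rank {S = S} g = subst (ℕ._≤ _) (greedy-size g)
    (ℕ.+-mono-≤ (rank (lookup S zero) (greedy-independent g zero))
                (rank (lookup S (suc zero)) (greedy-independent g (suc zero))))

  module _ (nonneg : NonNegative f) (submodular : Submodular f) where

    greedy-charged : ∀ {O} → Independent M O → ∀ {k S} → Greedy k S →
                     Charged M f O (lookup S zero) (lookup S (suc zero))
    greedy-charged O-ind start = charged-⊥ M f nonneg O-ind
    greedy-charged {O} O-ind (grow {S = S₁ ∷ S₂ ∷ []} {zero} {e} g c) =
      charged-grow M f submodular {O} {S₁} {S₂} {e} (greedy-charged O-ind g)
        (proj₁ (isCandidate c)) (proj₁ (proj₂ (isCandidate c))) (proj₂ (proj₂ (isCandidate c)))
        (gain≥0 c)
        (λ {u} u∉S₁ u∉S₂ ind → isMaximal c zero u (u∉S₁ , u∉S₂ , ind))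
        (λ {u} u∉S₁ u∉S₂ ind → isMaximal c (suc zero) u (u∉S₁ , u∉S₂ , ind))
    greedy-charged {O} O-ind (grow {S = S₁ ∷ S₂ ∷ []} {suc zero} {e} g c) =
      charged-sym M f {O} {S₂ ∪ ⁅ e ⁆} {S₁}
        (charged-grow M f submodular {O} {S₂} {S₁} {e}
          (charged-sym M f {O} {S₁} {S₂} (greedy-charged O-ind g))
          (proj₁ (proj₂ (isCandidate c))) (proj₁ (isCandidate c)) (proj₂ (proj₂ (isCandidate c)))
          (gain≥0 c)
          (λ {u} u∉S₂ u∉S₁ ind → isMaximal c (suc zero) u (u∉S₁ , u∉S₂ , ind))
          (λ {u} u∉S₂ u∉S₁ ind → isMaximal c zero u (u∉S₁ , u∉S₂ , ind)))

    greedy-approximates : ∀ {k S} → Greedy k S → Exhausted S → ∀ j →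
      (∀ i → f (lookup S i) ≤ f (lookup S j)) → Approximates M f (+ 1 / 4) (lookup S j)
    greedy-approximates {S = S₁ ∷ S₂ ∷ []} g exhausted j best =
      greedy-independent g j , λ O O-ind →
        x≤4y⇒¼x≤y {f O} {f S*}
          (≤-trans {f O} {(f S₁ + f S₂) + (f S₁ + f S₂)} {(f S* + f S*) + (f S* + f S*)}
            (charged-bound M f submodular {O} {S₁} {S₂} nonneg (greedy-disjoint g)
              (greedy-charged O-ind g)
              (λ {u} u∉S₁ u∉S₂ ind → exhausted zero u (u∉S₁ , u∉S₂ , ind))
              (λ {u} u∉S₁ u∉S₂ ind → exhausted (suc zero) u (u∉S₁ , u∉S₂ , ind)))
            (+-mono-≤ {f S₁ + f S₂} {f S* + f S*} {f S₁ + f S₂} {f S* + f S*} half half))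
      where
      S* = lookup (S₁ ∷ S₂ ∷ []) j
      half : f S₁ + f S₂ ≤ f S* + f S*
      half = +-mono-≤ {f S₁} {f S*} {f S₂} {f S*} (best zero) (best (suc zero))

-- Total correctness of oracle programs, with a time bound

module Correctness {n : ℕ} (M : Matroid n) (f : Subset n → ℝ) where

  open Execution M f

  -- Ensures p b Q: no execution of p blocks or takes more than b steps, and
  -- every result satisfies Q.  In the rule for loops, P is the postcondition
  -- of a single run of the body, b its budget, and c the budget of what
  -- follows, which is another round of the loop or the continuation k.

  data Ensures : {A : Set} → Comp n A → ℕ → (A → Set) → Set₁ where
    ret     : ∀ {A x b} {Q : A → Set} → Q x → Ensures (return x) b Q
    ask     : ∀ {A B b} {o : Op n B} {k : B → Comp n A} {Q : A → Set} →
              (∀ x → Answers o x → Ensures (k x) b Q) → Ensures (call o k) (suc b) Q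
    iterate : ∀ {A X Y b c d} {body : X → Comp n (X ⊎ Y)} {x} {k : Y → Comp n A}
              {P : X ⊎ Y → Set} {Q : A → Set} → b ℕ.+ c ℕ.≤ d →
              Ensures (body x) b P →
              (∀ y → P y → Ensures ([ (λ x′ → loop body x′ k) , k ]′ y) c Q) →
              Ensures (loop body x k) (suc d) Q

  weaken : ∀ {A} {p : Comp n A} {b c} {P Q : A → Set} → Ensures p b P → b ℕ.≤ c →
           (∀ {x} → P x → Q x) → Ensures p c Q
  weaken (ret Px)              b≤c         P⊆Q = ret (P⊆Q Px)
  weaken (ask ans)             (ℕ.s≤s b≤c) P⊆Q = ask λ x a → weaken (ans x a) b≤c P⊆Q
  weaken (iterate b≤d body rest) (ℕ.s≤s d≤c) P⊆Q =
    iterate (ℕ.≤-trans b≤d d≤c) body λ y Py → weaken (rest y Py) ℕ.≤-refl P⊆Q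

  bind : ∀ {A B} {p : Comp n A} {h : A → Comp n B} {b c} {P : A → Set} {Q : B → Set} →
         Ensures p b P → (∀ x → P x → Ensures (h x) c Q) → Ensures (p >>= h) (b ℕ.+ c) Q
  bind {b = b} {c} (ret Px) rest = weaken (rest _ Px) (ℕ.m≤n+m c b) id
  bind (ask ans) rest = ask λ x a → bind (ans x a) rest
  bind {c = c} (iterate {b = b} {c = c′} {d = d} b≤d body after) rest = iterate
    (subst (ℕ._≤ d ℕ.+ c) (ℕ.+-assoc b c′ c) (ℕ.+-monoˡ-≤ c b≤d)) body
    λ where
      (inj₁ x) Px → bind (after (inj₁ x) Px) rest
      (inj₂ y) Py → bind (after (inj₂ y) Py) rest

  ensures-step : ∀ {A} {p q : Comp n A} {b Q} → Ensures p b Q → p ⟶ q →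
                 ∃ λ c → b ≡ suc c × Ensures q c Q
  ensures-step (ask ans) (answer {x = x} a) = _ , refl , ans x a
  ensures-step (iterate b≤d body rest) unroll = _ , refl , weaken (bind body rest) b≤d id

  ensures-terminates : ∀ {A} {p : Comp n A} {b Q} → Ensures p b Q → Terminates p
  ensures-terminates {b = zero} e = acc λ p⟶q → case-zero (ensures-step e p⟶q)
    where
    case-zero : ∀ {q Q} → (∃ λ c → zero ≡ suc c × Ensures q c Q) → Terminates q
    case-zero (_ , () , _)
  ensures-terminates {b = suc b} e = acc λ p⟶q → case-suc (ensures-step e p⟶q)
    where
    case-suc : ∀ {q Q} → (∃ λ c → suc b ≡ suc c × Ensures q c Q) → Terminates q
    case-suc (_ , refl , e′) = ensures-terminates e′

  ensures-time : ∀ {A} {p q : Comp n A} {b t Q} → Ensures p b Q → p ⟶[ t ] q → t ℕ.≤ b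
  ensures-time e done = ℕ.z≤n
  ensures-time e (step p⟶q run) with _ , refl , e′ ← ensures-step e p⟶q =
    ℕ.s≤s (ensures-time e′ run)

  -- No operation blocks.  Excluded middle for independence and totality of
  -- the order hold only up to double negation, which suffices to refute that
  -- a call has halted.

  answerable : ∀ {B} (o : Op n B) → ¬ ¬ (∃ λ x → Answers o x)
  answerable (independent? S) ¬ans = ¬ans (false , ofⁿ λ ind → ¬ans (true , ofʸ ind))
  answerable (value S)        ¬ans = ¬ans (_ , refl)
  answerable (member? e S)    ¬ans = ¬ans (false , ofⁿ λ e∈S → ¬ans (true , ofʸ e∈S))
  answerable (insert e S)     ¬ans = ¬ans (_ , refl)
  answerable (subtract x y)   ¬ans = ¬ans (_ , refl)
  answerable (nonpositive? x) ¬ans = ¬ans (false , ofⁿ λ x≤0 → ¬ans (true , ofʸ x≤0))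
  answerable (compare x y)    ¬ans =
    ≤-total {x} {y} λ where
      (inj₁ x≤y) → ¬ans (true , x≤y)
      (inj₂ y≤x) → ¬ans (false , y≤x)

  ensures-result : ∀ {A} {p q : Comp n A} {b t Q} → Ensures p b Q → p ⟶[ t ] q → Halted q →
                   ∃ λ x → q ≡ return x × Q x
  ensures-result (ret Qx) done halted = _ , refl , Qx
  ensures-result (ask {o = o} _) done halted =
    contradiction (λ (x , a) → halted _ (answer a)) (answerable o)
  ensures-result (iterate _ _ _) done halted = contradiction unroll (halted _)
  ensures-result e (step p⟶q run) halted with _ , _ , e′ ← ensures-step e p⟶q =
    ensures-result e′ run halted

-- Correctness of TwinGreedy

module _ {n : ℕ} (M : Matroid n) (f : Subset n → ℝ) where

  open Execution M f
  open Correctness M f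

  module _ (S : Twins {n}) where

    -- If a best candidate is stored, it is one, and its gain is correct.

    Sound : Maybe (Candidate {n}) → Set
    Sound nothing            = ⊤
    Sound (just (i , e , g)) = IsCandidate M S i e × g ≡ gain f (lookup S i) e

    -- The stored candidate is at least as good as (j , u), if the latter is a
    -- candidate at all; nothing is worse than every candidate.

    Dominates : Maybe (Candidate {n}) → Fin 2 × Fin n → Set
    Dominates nothing            (j , u) = ¬ IsCandidate M S j u
    Dominates (just (i , e , g)) (j , u) = IsCandidate M S j u → gain f (lookup S j) u ≤ g

    -- The effect of scanning the pairs new: best′ dominates them, and whatever
    -- best dominated.

    record Improves (best : Maybe Candidate) (new : List (Fin 2 × Fin n))
                    (best′ : Maybe Candidate) : Set where
      field
        sound     : Sound best′
        dominates : All (Dominates best′) new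
        preserves : ∀ c → Dominates best c → Dominates best′ c

    open Improves public

    improves-trans : ∀ {best best′ best″ c cs} → Improves best (c ∷ []) best′ →
                     Improves best′ cs best″ → Improves best (c ∷ cs) best″
    improves-trans {c = c} i i′ = record
      { sound     = sound i′
      ; dominates = preserves i′ c (All.head (dominates i)) ∷ dominates i′
      ; preserves = λ c → preserves i′ c ∘ preserves i c
      }

    keep-noncandidate : ∀ {best j u} → Sound best → ¬ IsCandidate M S j u → Improves best ((j , u) ∷ []) best
    keep-noncandidate {nothing} s ¬cand = record { sound = s ; dominates = ¬cand ∷ [] ; preserves = λ _ d → d }
    keep-noncandidate {just _}  s ¬cand = record
      { sound = s ; dominates = (λ cand → contradiction cand ¬cand) ∷ [] ; preserves = λ _ d → d }

    keep-better : ∀ {i e g₀ j u g} → Sound (just (i , e , g₀)) →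
                  g ≡ gain f (lookup S j) u → g ≤ g₀ →
                  Improves (just (i , e , g₀)) ((j , u) ∷ []) (just (i , e , g₀))
    keep-better s refl g≤g₀ .sound         = s
    keep-better s refl g≤g₀ .dominates     = (λ _ → g≤g₀) ∷ []
    keep-better s refl g≤g₀ .preserves _ d = d

    replace : ∀ {i e g₀ j u g} → IsCandidate M S j u → g ≡ gain f (lookup S j) u → g₀ ≤ g →
              Improves (just (i , e , g₀)) ((j , u) ∷ []) (just (j , u , g))
    replace cand refl g₀≤g .sound = cand , refl
    replace {g = g} cand refl g₀≤g .dominates = (λ _ → ≤-refl {g}) ∷ []
    replace {g₀ = g₀} {g = g} cand refl g₀≤g .preserves (j′ , u′) d cand′ =
      ≤-trans {gain f (lookup S j′) u′} {g₀} {g} (d cand′) g₀≤g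

    better-ensures : ∀ {best j u g} → Sound best → IsCandidate M S j u → g ≡ gain f (lookup S j) u →
      Ensures (better best (j , u , g)) 1 (λ c → Improves best ((j , u) ∷ []) (just c))
    better-ensures {nothing} {j} {u} {g} s cand g≡ = ret record
      { sound     = cand , g≡
      ; dominates = (λ _ → ≤-reflexive {gain f (lookup S j) u} {g} (sym g≡)) ∷ []
      ; preserves = λ c ¬cand cand → contradiction cand ¬cand
      }
    better-ensures {just (i , e , g₀)} {j} {u} {g} s cand g≡ = ask compared
      where
      compared : ∀ b → Answers (compare g g₀) b →
        Ensures (return (if b then (i , e , g₀) else (j , u , g))) 0
        (λ c → Improves (just (i , e , g₀)) ((j , u) ∷ []) (just c))
      compared true  g≤g₀ = ret (keep-better {i} {e} {g₀} {j} {u} {g} s g≡ g≤g₀)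
      compared false g₀≤g = ret (replace {i} {e} {g₀} {j} {u} {g} cand g≡ g₀≤g)

    update-ensures : ∀ {best j u g} → Sound best → IsCandidate M S j u → g ≡ gain f (lookup S j) u →
      Ensures (better best (j , u , g) >>= λ c → return (just c)) 1 (Improves best ((j , u) ∷ []))
    update-ensures {best} {j} {u} {g} s cand g≡ =
      bind {p = better best (j , u , g)} {b = 1} {c = 0}
        (better-ensures {best} {j} {u} {g} s cand g≡) λ _ i → ret i

    gain-computed : ∀ {A T u a b g} → T ≡ A ∪ ⁅ u ⁆ → a ≡ f T → b ≡ f A → g ≡ a - b → g ≡ gain f A u
    gain-computed refl refl refl g≡ = g≡

    consider-ensures : ∀ {best} → Sound best → ∀ j u →
      Ensures (consider S j u best) 8 (Improves best ((j , u) ∷ []))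
    consider-ensures {best} s j u = ask λ where
      _ (ofʸ u∈S₁) → ask λ _ _ → ret (keep-noncandidate {best} {j} {u} s λ (u∉S₁ , _) → u∉S₁ u∈S₁)
      _ (ofⁿ u∉S₁) → ask λ where
        _ (ofʸ u∈S₂) → ret (keep-noncandidate {best} {j} {u} s λ (_ , u∉S₂ , _) → u∉S₂ u∈S₂)
        _ (ofⁿ u∉S₂) → ask λ T T≡ → ask λ where
          _ (ofⁿ ¬ind) → ret (keep-noncandidate {best} {j} {u} s λ (_ , _ , ind) →
                           ¬ind (subst (Independent M) (sym T≡) ind))
          _ (ofʸ ind)  → ask λ a a≡ → ask λ b b≡ → ask λ g g≡ →
            update-ensures {best} {j} {u} {g} s (u∉S₁ , u∉S₂ , subst (Independent M) T≡ ind)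
              (gain-computed {lookup S j} {T} {u} {a} {b} {g} T≡ a≡ b≡ g≡)

    scan-ensures : ∀ {best} → Sound best → ∀ cs →
      Ensures (scan S cs best) (length cs ℕ.* 8) (Improves best cs)
    scan-ensures s []             = ret record { sound = s ; dominates = [] ; preserves = λ _ d → d }
    scan-ensures s ((j , u) ∷ cs) = bind (consider-ensures s j u) λ _ i →
      weaken (scan-ensures (sound i) cs) ℕ.≤-refl (improves-trans i)

    pairs : List (Fin 2 × Fin n)
    pairs = cartesianProduct (allFin 2) (allFin n)

    -- An iteration either makes a greedy addition or stops for want of one.

    Outcome : Twins {n} ⊎ Twins {n} → Set
    Outcome (inj₁ S′) = ∃ λ i → ∃ λ e → GreedyChoice M f S i e × S′ ≡ S [ i ]≔ (lookup S i ∪ ⁅ e ⁆)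
    Outcome (inj₂ S′) = S′ ≡ S × Exhausted M f S

    dominates-all : ∀ {best best′} → Improves best pairs best′ → ∀ j u → Dominates best′ (j , u)
    dominates-all i j u = All.lookup (dominates i) (∈-cartesianProduct⁺ (∈-allFin j) (∈-allFin u))

    iteration-ensures : Ensures (iteration S) (length pairs ℕ.* 8 ℕ.+ 2) Outcome
    iteration-ensures = bind (scan-ensures tt pairs) λ where
      nothing i → ret (refl , λ j u cand → contradiction cand (dominates-all i j u))
      (just (i , e , g)) imp → ask λ where
        _ (ofʸ g≤0) → ret (refl , λ j u cand →
          ≤-trans {gain f (lookup S j) u} {g} {0ℝ} (dominates-all imp j u cand) g≤0)
        _ (ofⁿ g≰0) → ask λ where
          _ refl → ret (i , e , record
            { isCandidate = proj₁ (sound imp)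
            ; gain≥0      = subst (0ℝ ≤_) (proj₂ (sound imp)) (≰⇒≥ {g} {0ℝ} g≰0)
            ; isMaximal   = λ j u cand →
                subst (gain f (lookup S j) u ≤_) (proj₂ (sound imp)) (dominates-all imp j u cand)
            } , refl)

  module _ {r : ℕ} (rank : ∀ S → Independent M S → ∣ S ∣ ℕ.≤ r) where

    -- The budget of a single run of the loop body.

    cost : ℕ
    cost = length (pairs (⊥ ∷ ⊥ ∷ [])) ℕ.* 8 ℕ.+ 2

    -- After m additions fewer than fuel further ones are possible, since at
    -- most 2 r elements can be added; what follows the loop takes at most c
    -- steps.

    loop-ensures : ∀ {A k c} {Q : A → Set} →
      (∀ {m S} → Greedy M f m S → Exhausted M f S → Ensures (k S) c Q) →
      ∀ fuel {m S} → Greedy M f m S → r ℕ.+ r ℕ.< m ℕ.+ fuel →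
      Ensures (loop iteration S k) (fuel ℕ.* suc cost ℕ.+ c) Q
    loop-ensures after zero {m} g 2r<m =
      contradiction (greedy-length M f rank g) (ℕ.<⇒≱ (subst (r ℕ.+ r ℕ.<_) (ℕ.+-identityʳ m) 2r<m))
    loop-ensures {c = c} after (suc fuel) {m} {S} g 2r<m = iterate
      (ℕ.≤-reflexive (sym (ℕ.+-assoc cost (fuel ℕ.* suc cost) c))) (iteration-ensures S)
      λ where
        (inj₁ _) (i , e , choice , refl) →
          loop-ensures after fuel (grow g choice) (subst (r ℕ.+ r ℕ.<_) (ℕ.+-suc m fuel) 2r<m)
        (inj₂ _) (refl , exhausted) →
          weaken (after g exhausted) (ℕ.m≤n+m c (fuel ℕ.* suc cost)) id

    twinGreedy-ensures : NonNegative f → Submodular f →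
      Ensures twinGreedy (suc (r ℕ.+ r) ℕ.* suc cost ℕ.+ 3) (Approximates M f (+ 1 / 4))
    twinGreedy-ensures nonneg submodular =
      loop-ensures compare-results (suc (r ℕ.+ r)) start ℕ.≤-refl
      where
      compare-results : ∀ {m S} → Greedy M f m S → Exhausted M f S → Ensures _ 3 _
      compare-results {S = S} g exhausted = ask λ where
        _ refl → ask λ where
          _ refl → ask λ where
            true  f₁≤f₂ → ret (greedy-approximates M f nonneg submodular g exhausted (suc zero)
              λ where
                zero       → f₁≤f₂
                (suc zero) → ≤-refl {f (lookup S (suc zero))})
            false f₂≤f₁ → ret (greedy-approximates M f nonneg submodular g exhausted zero
              λ where
                zero       → ≤-refl {f (lookup S zero)}
                (suc zero) → f₂≤f₁)

    time-bound : 1 ℕ.≤ r → r ℕ.≤ n →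
      suc (r ℕ.+ r) ℕ.* suc cost ℕ.+ 3 ℕ.≤ 60 ℕ.* (n ℕ.* r)
    time-bound 1≤r r≤n = begin
      suc (r ℕ.+ r) ℕ.* suc cost ℕ.+ 3
        ≤⟨ ℕ.+-mono-≤ (ℕ.*-mono-≤ (ℕ.+-monoˡ-≤ (r ℕ.+ r) 1≤r) cost≤)
             (ℕ.*-monoʳ-≤ 3 (ℕ.*-mono-≤ 1≤n 1≤r)) ⟩
      (r ℕ.+ (r ℕ.+ r)) ℕ.* (16 ℕ.* n ℕ.+ 3 ℕ.* n) ℕ.+ 3 ℕ.* (n ℕ.* r)
        ≡⟨ ℕSolver.+-*-Solver.solve 2 (λ n r → (r :+ (r :+ r)) :* (con 16 :* n :+ con 3 :* n) :+ con 3 :* (n :* r)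
             := con 60 :* (n :* r)) refl n r ⟩
      60 ℕ.* (n ℕ.* r) ∎
      where
      open ℕ.≤-Reasoning
      open ℕSolver.+-*-Solver using (_:+_; _:*_; _:=_; con)
      1≤n = ℕ.≤-trans 1≤r r≤n
      length-pairs : length (pairs (⊥ ∷ ⊥ ∷ [])) ≡ n ℕ.+ (n ℕ.+ 0)
      length-pairs = trans (length-++ (map (zero ,_) (allFin n)))
        (cong₂ ℕ._+_ (row zero)
          (trans (length-++ (map (suc zero ,_) (allFin n))) (cong (ℕ._+ 0) (row (suc zero)))))
        where
        row : ∀ (j : Fin 2) → length (map (j ,_) (allFin n)) ≡ n
        row j = trans (length-map (j ,_) (allFin n)) (length-tabulate id)
      cost≤ : suc cost ℕ.≤ 16 ℕ.* n ℕ.+ 3 ℕ.* n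
      cost≤ = begin
        suc cost
          ≡⟨ cong (λ l → suc (l ℕ.* 8 ℕ.+ 2)) length-pairs ⟩
        suc ((n ℕ.+ (n ℕ.+ 0)) ℕ.* 8 ℕ.+ 2)
          ≡⟨ ℕSolver.+-*-Solver.solve 1 (λ n → con 1 :+ ((n :+ (n :+ con 0)) :* con 8 :+ con 2)
               := con 16 :* n :+ con 3) refl n ⟩
        16 ℕ.* n ℕ.+ 3
          ≤⟨ ℕ.+-monoʳ-≤ (16 ℕ.* n) (ℕ.*-monoʳ-≤ 3 1≤n) ⟩
        16 ℕ.* n ℕ.+ 3 ℕ.* n ∎

theorem1 : ∃ λ (C : ℕ) →
    ∀ {n r : ℕ} (M : Matroid n) → HasRank M r →
    (f : Subset n → ℝ) → NonMonotone f → NonNegative f → Submodular f →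
    let open Execution M f in
    Terminates twinGreedy
    × (∀ {t p} → twinGreedy ⟶[ t ] p → Halted p →
    ∃ λ S* → p ≡ return S* × Approximates M f (+ 1 / 4) S*)
    × (1 ℕ.≤ r → ∀ {t p} → twinGreedy ⟶[ t ] p → t ℕ.≤ C ℕ.* (n ℕ.* r))
-- The constant 60 is 3 · 19 + 3: with 1 ≤ r ≤ n there are 2 r + 1 ≤ 3 r rounds
-- of 16 n + 3 ≤ 19 n steps, and 3 ≤ 3 n r steps for the final comparison.
theorem1 = 60 , λ {n} {r} M ((S , _ , ∣S∣≡r) , rank) f _ nonneg submodular →
  let open Correctness M f
      ensures = twinGreedy-ensures M f rank nonneg submodular
  in ensures-terminates ensures ,
     ensures-result ensures ,
     λ 1≤r run → ℕ.≤-trans (ensures-time ensures run)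
       (time-bound M f rank 1≤r (subst (ℕ._≤ n) ∣S∣≡r (∣p∣≤n S)))
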